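{- Let $n \geq 1$ and let $G$ be the hypertree $HT(n)$. Then the locating-total domination number of $G$ is $$\gamma^{L}_t(G) = \begin{cases} \frac{1}{7}(3\cdot 2^{n+1}+1) & \text{if } n\equiv 0 \pmod 3,\\ \frac{2}{7}(3\cdot 2^{n}+1) & \text{if } n\equiv 1 \pmod 3,\\ \frac{3}{7}(2^{n+1}-1) & \text{if } n\equiv 2 \pmod 3.\end{cases}$$
   Context: The hypertree $HT(n)$ has vertex set $\{1,2,\dots,2^{n+1}-1\}$. Its edges are the edges of the complete binary tree of height $n$ in which vertex $x$ has children $2x$ and $2x+1$ (the root is $1$, at level $0$; vertex $v$ lies at level $i$ iff $2^i \le v \le 2^{i+1}-1$), together with horizontal edges: for each level $i\ge 1$, two vertices at level $i$ are adjacent if their labels differ by $2^{i-1}$. A locating-total dominating set of $G$ is a set $S\subseteq V(G)$ such that every vertex of $V(G)$ is adjacent to some vertex of $S$, and for every two distinct vertices $u,v\in V(G)\setminus S$, $N(u)\cap S\neq N(v)\cap S$ (where $N(x)$ is the open neighborhood). $\gamma^{L}_t(G)$ is the minimum cardinality of a locating-total dominating set. -}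

module Defs where

open import Data.Nat using (ℕ; _+_; _*_; _∸_; _^_; _≤_; _<_)
open import Data.Product using (Σ; _×_; ∃-syntax)
open import Data.Sum using (_⊎_)
open import Data.List using (List; length)
open import Data.List.Membership.Propositional using (_∈_; _∉_)
open import Data.List.Relation.Unary.All using (All)
open import Data.List.Relation.Unary.Unique.Propositional using (Unique)
open import Relation.Binary.PropositionalEquality using (_≡_; _≢_)
open import Relation.Nullary using (¬_)
open import Function.Bundles using (_⇔_)

Vertex : ℕ → ℕ → Set
Vertex n v = 1 ≤ v × v < 2 ^ (n + 1)

AtLevel : ℕ → ℕ → Set
AtLevel i v = 2 ^ i ≤ v × v < 2 ^ (i + 1)

Child : ℕ → ℕ → Set
Child u v = v ≡ 2 * u ⊎ v ≡ 2 * u + 1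

Horizontal : ℕ → ℕ → Set
Horizontal u v = Σ ℕ λ i → 1 ≤ i × AtLevel i u × AtLevel i v ×
                 (v ≡ u + 2 ^ (i ∸ 1) ⊎ u ≡ v + 2 ^ (i ∸ 1))

Adj : ℕ → ℕ → ℕ → Set
Adj n u v = Vertex n u × Vertex n v × (Child u v ⊎ Child v u ⊎ Horizontal u v)

IsLTDS : ℕ → List ℕ → Set
IsLTDS n S =
  Unique S × All (Vertex n) S ×
  (∀ v → Vertex n v → ∃[ w ] (w ∈ S × Adj n v w)) ×
  (∀ u v → Vertex n u → Vertex n v → u ≢ v → u ∉ S → v ∉ S →
     ¬ (∀ w → w ∈ S → (Adj n u w ⇔ Adj n v w)))

IsLTDNumber : ℕ → ℕ → Set
IsLTDNumber n k =
  (∃[ S ] (IsLTDS n S × length S ≡ k)) ×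
  (∀ S → IsLTDS n S → k ≤ length S)

{-# OPTIONS --safe #-}
module Submission where

-- For n ≥ 1, HT(n) is the Cartesian product of a complete binary tree with
-- K₂ plus an apex joined to the two copies of the root: the fibres are the
-- pairs of horizontally adjacent vertices.
--
-- Lower bound: take a pair with its two child pairs and the pairs below
-- those.  Its four children must be dominated from within this group; only
-- the top pair can dominate two of them at once, and if the top pair did all
-- the work then sibling children would not be located.  So every group has
-- three chosen vertices.  Stacking such groups in bands of three levels, from
-- the bottom up, leaves at most three levels around the root, where 0, 1 or 2
-- further vertices are forced.
--
-- Upper bound: in the bottom band of levels n − 2, n − 1, n choose all of
-- level n − 1 and one leaf per group.  Then level n − 2 is located by its
-- pairs of chosen children, and nothing chosen is adjacent to higher levels,
-- so the construction repeats on HT(n − 3).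

open import Defs
open import Data.Bool using (Bool; true; false; not)
import Data.Bool.Properties as Bool
open import Data.Empty using (⊥-elim)
open import Data.List using (List; []; _∷_; _++_; length; map; concatMap)
import Data.List.Membership.DecPropositional as DecMembership
open import Data.List.Membership.Propositional using (_∈_; _∉_; find; lose)
open import Data.List.Membership.Propositional.Properties using (∈-∃++; ∈-++⁺ˡ; ∈-++⁺ʳ; ∈-++⁻; ∈-map⁺; ∈-map⁻; ∈-concatMap⁺; ∈-concatMap⁻)
open import Data.List.Properties using (length-++; length-map)
open import Data.List.Relation.Binary.Subset.Propositional using (_⊆_)
open import Data.List.Relation.Unary.All as All using (All; []; _∷_)
import Data.List.Relation.Unary.All.Properties as All
open import Data.List.Relation.Unary.AllPairs using ([]; _∷_)
open import Data.List.Relation.Unary.Any using (here; there)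
open import Data.List.Relation.Unary.Unique.Propositional using (Unique)
import Data.List.Relation.Unary.Unique.Propositional.Properties as Unique
open import Data.Nat using (ℕ; zero; suc; _+_; _*_; _∸_; _^_; _≤_; _<_; _%_; z≤n; s≤s; s≤s⁻¹)
open import Data.Nat.Properties
open import Data.Nat.Tactic.RingSolver using (solve-∀)
open import Data.Product using (Σ; _×_; _,_; proj₁; proj₂; ∃-syntax)
open import Data.Sum using (_⊎_; inj₁; inj₂)
open import Data.Vec using (Vec; []; _∷_)
open import Function using (_∘_)
open import Function.Bundles using (_⇔_; mk⇔; module Equivalence)
open import Relation.Binary.Definitions using (tri<; tri≈; tri>)
open import Relation.Binary.PropositionalEquality using (_≡_; _≢_; refl; sym; trans; cong; cong₂; subst; subst₂)
open import Relation.Nullary using (¬_; Dec; yes; no; contradiction)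

-- Cardinality of duplicate-free lists

unique-⊆⇒length-≤ : {A : Set} {xs ys : List A} → Unique xs → xs ⊆ ys → length xs ≤ length ys
unique-⊆⇒length-≤ {xs = []} _ _ = z≤n
unique-⊆⇒length-≤ {xs = x ∷ xs} (x∉xs ∷ u) xs⊆ys with ∈-∃++ (xs⊆ys (here refl))
... | as , bs , refl = begin
  suc (length xs)            ≤⟨ s≤s (unique-⊆⇒length-≤ u rest) ⟩
  suc (length (as ++ bs))    ≡⟨ cong suc (length-++ as) ⟩
  suc (length as + length bs) ≡⟨ +-suc (length as) (length bs) ⟨
  length as + suc (length bs) ≡⟨ length-++ as ⟨
  length (as ++ x ∷ bs)      ∎
  where
  open ≤-Reasoning
  rest : xs ⊆ as ++ bs
  rest z∈xs with ∈-++⁻ as (xs⊆ys (there z∈xs))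
  ... | inj₁ z∈as         = ∈-++⁺ˡ z∈as
  ... | inj₂ (here refl)  = contradiction refl (All.lookup x∉xs z∈xs)
  ... | inj₂ (there z∈bs) = ∈-++⁺ʳ as z∈bs

-- Vertices as tree paths

-- node t b lies at level 1 + m; the head of t is the last branching, and b
-- tells on which side of the root the vertex lies.
data Node : Set where
  apex : Node
  node : ∀ {m} → Vec Bool m → Bool → Node

level : Node → ℕ
level apex           = 0
level (node {m} _ _) = suc m

child : Bool → Node → Node
child c apex       = node [] c
child c (node t b) = node (c ∷ t) b

infix 4 _~_
-- Adjacency in the infinite hypertree; the height enters only through bounds on `level`. Horizontal
-- neighbours share `t` and differ in `b`.
data _~_ : Node → Node → Set where
  apex↓   : ∀ {b} → apex ~ node [] b
  apex↑   : ∀ {b} → node [] b ~ apex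
  down    : ∀ {m} {t : Vec Bool m} {b c} → node t b ~ node (c ∷ t) b
  up      : ∀ {m} {t : Vec Bool m} {b c} → node (c ∷ t) b ~ node t b
  across→ : ∀ {m} {t : Vec Bool m} → node t false ~ node t true
  across← : ∀ {m} {t : Vec Bool m} → node t true ~ node t false

~-child : ∀ c v → v ~ child c v
~-child c apex       = apex↓
~-child c (node t b) = down

-- Binary labels

bit : Bool → ℕ
bit false = 0
bit true  = 1

-- In binary the label reads: a leading 1, then `b`, then the entries of `t` from the last to the
-- head.
label : Node → ℕ
label apex             = 1
label (node [] b)      = 2 * 1 + bit b
label (node (c ∷ t) b) = 2 * label (node t b) + bit c

label-child : ∀ c v → label (child c v) ≡ 2 * label v + bit c
label-child c apex       = refl
label-child c (node t b) = refl

level-child : ∀ c v → level (child c v) ≡ suc (level v)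
level-child c apex       = refl
level-child c (node t b) = refl

2*-bit-injective : ∀ x y c d → 2 * x + bit c ≡ 2 * y + bit d → x ≡ y × c ≡ d
2*-bit-injective x y false false e rewrite +-identityʳ (2 * x) | +-identityʳ (2 * y) = *-cancelˡ-≡ x y 2 e , refl
2*-bit-injective x y false true  e rewrite +-identityʳ (2 * x) = ⊥-elim (even≢odd x y (trans e (+-comm (2 * y) 1)))
2*-bit-injective x y true  false e rewrite +-identityʳ (2 * y) = ⊥-elim (even≢odd y x (trans (sym e) (+-comm (2 * x) 1)))
2*-bit-injective x y true  true  e = *-cancelˡ-≡ x y 2 (+-cancelʳ-≡ 1 (2 * x) (2 * y) e) , refl

label-lower : ∀ v → 2 ^ level v ≤ label v
label-lower apex             = ≤-refl
label-lower (node [] b)      = m≤m+n 2 (bit b)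
label-lower (node (c ∷ t) b) = m≤n⇒m≤n+o (bit c) (*-monoʳ-≤ 2 (label-lower (node t b)))

2*-bit-< : ∀ {x y} c → x < y → 2 * x + bit c < 2 * y
2*-bit-< {x} {y} c x<y = begin-strict
  2 * x + bit c ≤⟨ +-monoʳ-≤ (2 * x) (bit≤1 c) ⟩
  2 * x + 1     <⟨ n<1+n _ ⟩
  suc (2 * x + 1) ≡⟨ double-suc x ⟩
  2 * suc x     ≤⟨ *-monoʳ-≤ 2 x<y ⟩
  2 * y         ∎
  where
  open ≤-Reasoning
  bit≤1 : ∀ c → bit c ≤ 1
  bit≤1 false = z≤n
  bit≤1 true  = ≤-refl
  double-suc : ∀ x → suc (2 * x + 1) ≡ 2 * suc x
  double-suc = solve-∀

label-upper : ∀ v → label v < 2 ^ suc (level v)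
label-upper apex             = ≤-refl
label-upper (node [] b)      = 2*-bit-< {1} {2} b ≤-refl
label-upper (node (c ∷ t) b) = 2*-bit-< c (label-upper (node t b))

1≤label : ∀ v → 1 ≤ label v
1≤label v = ≤-trans (m^n>0 2 (level v)) (label-lower v)

label-node≢1 : ∀ {m} (t : Vec Bool m) b → 1 ≢ label (node t b)
label-node≢1 {m} t b e with subst (2 ≤_) (sym e) (≤-trans (*-monoʳ-≤ 2 (m^n>0 2 m)) (label-lower (node t b)))
... | s≤s ()

label-injective : ∀ {v w} → label v ≡ label w → v ≡ w
label-injective {apex}             {apex}             e = refl
label-injective {apex}             {node t b}         e = ⊥-elim (label-node≢1 t b e)
label-injective {node t b}         {apex}             e = ⊥-elim (label-node≢1 t b (sym e))
label-injective {node [] b}        {node [] b′}       e = cong (node []) (proj₂ (2*-bit-injective 1 1 b b′ e))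
label-injective {node [] b}        {node (c ∷ t) b′}  e =
  ⊥-elim (label-node≢1 t b′ (proj₁ (2*-bit-injective 1 (label (node t b′)) b c e)))
label-injective {node (c ∷ t) b}   {node [] b′}       e =
  ⊥-elim (label-node≢1 t b (sym (proj₁ (2*-bit-injective (label (node t b)) 1 c b′ e))))
label-injective {node (c ∷ t) b}   {node (d ∷ s) b′}  e =
  let e′ , c≡d = 2*-bit-injective (label (node t b)) (label (node s b′)) c d e
  in cong₂ child c≡d (label-injective {node t b} {node s b′} e′)

-- Binary successor with the carry running from the head of `t` towards `b`; an overflow at `b`
-- opens the next level. It reduces surjectivity of `label` to ordinary induction.
next : Node → Node
next apex                 = node [] false
next (node [] false)      = node [] true
next (node [] true)       = node (false ∷ []) false
next (node (false ∷ t) b) = node (true ∷ t) b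
next (node (true ∷ t) b)  = child false (next (node t b))

label-next : ∀ v → label (next v) ≡ suc (label v)
label-next apex                 = refl
label-next (node [] false)      = refl
label-next (node [] true)       = refl
label-next (node (false ∷ t) b) = +-suc (2 * label (node t b)) 0
label-next (node (true ∷ t) b)  =
  trans (label-child false (next (node t b)))
        (trans (cong (λ x → 2 * x + 0) (label-next (node t b))) (carry (label (node t b))))
  where
  carry : ∀ x → 2 * suc x + 0 ≡ suc (2 * x + 1)
  carry = solve-∀

label-surjective : ∀ x → 1 ≤ x → ∃[ v ] label v ≡ x
label-surjective 1             _ = apex , refl
label-surjective (suc (suc x)) _ with label-surjective (suc x) (s≤s z≤n)
... | v , e = next v , trans (label-next v) (cong suc e)

-- The digit `b` stands just after the leading 1 and has weight `2 ^ m`, which is exactly the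
-- horizontal offset at level `suc m`.
label-true : ∀ {m} (t : Vec Bool m) → label (node t true) ≡ label (node t false) + 2 ^ m
label-true []                  = refl
label-true {suc m} (c ∷ t) rewrite label-true t = distrib (label (node t false)) (2 ^ m) (bit c)
  where
  distrib : ∀ x p z → 2 * (x + p) + z ≡ 2 * x + z + 2 * p
  distrib = solve-∀

-- The vertices with b = true fill the upper half of their level, so adding the
-- horizontal offset leaves the level.
label-true-overflow : ∀ {m} (t : Vec Bool m) → 2 ^ suc (suc m) ≤ label (node t true) + 2 ^ m
label-true-overflow {m} t = begin
  2 ^ suc (suc m)                    ≡⟨ quadruple (2 ^ m) ⟩
  2 * 2 ^ m + 2 ^ m + 2 ^ m          ≤⟨ +-monoˡ-≤ (2 ^ m) (+-monoˡ-≤ (2 ^ m) (label-lower (node t false))) ⟩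
  label (node t false) + 2 ^ m + 2 ^ m ≡⟨ cong (_+ 2 ^ m) (label-true t) ⟨
  label (node t true) + 2 ^ m        ∎
  where
  open ≤-Reasoning
  quadruple : ∀ p → 2 * (2 * p) ≡ 2 * p + p + p
  quadruple = solve-∀

2^-level-unique : ∀ {i j x} → 2 ^ i ≤ x → x < 2 ^ suc i → 2 ^ j ≤ x → x < 2 ^ suc j → i ≡ j
2^-level-unique {i} {j} i≤ <i j≤ <j with <-cmp i j
... | tri≈ _ i≡j _ = i≡j
... | tri< i<j _ _ = contradiction (≤-trans (^-monoʳ-≤ 2 i<j) j≤) (<⇒≱ <i)
... | tri> _ _ j<i = contradiction (≤-trans (^-monoʳ-≤ 2 j<i) i≤) (<⇒≱ <j)

AtLevel⇒level : ∀ {i} v → AtLevel i (label v) → level v ≡ i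
AtLevel⇒level {i} v (lo , hi) rewrite +-comm i 1 =
  2^-level-unique (label-lower v) (label-upper v) lo hi

level⇒AtLevel : ∀ v → AtLevel (level v) (label v)
level⇒AtLevel v rewrite +-comm (level v) 1 = label-lower v , label-upper v

level⇒Vertex : ∀ {n} v → level v ≤ n → Vertex n (label v)
level⇒Vertex {n} v l≤n rewrite +-comm n 1 = 1≤label v , ≤-trans (label-upper v) (^-monoʳ-≤ 2 (s≤s l≤n))

Vertex⇒level : ∀ {n} v → Vertex n (label v) → level v ≤ n
Vertex⇒level {n} v (_ , hi) rewrite +-comm n 1 with level v ≤? n
... | yes l≤n = l≤n
... | no  l≰n = contradiction (≤-trans (^-monoʳ-≤ 2 (≰⇒> l≰n)) (label-lower v)) (<⇒≱ hi)

-- Agreement of path adjacency with label adjacency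

~-sym : ∀ {v w} → v ~ w → w ~ v
~-sym apex↓   = apex↑
~-sym apex↑   = apex↓
~-sym down    = up
~-sym up      = down
~-sym across→ = across←
~-sym across← = across→

Child⇒~ : ∀ v w → Child (label v) (label w) → v ~ w
Child⇒~ v w (inj₁ e) = subst (v ~_)
  (label-injective (trans (label-child false v) (trans (+-identityʳ _) (sym e)))) (~-child false v)
Child⇒~ v w (inj₂ e) = subst (v ~_)
  (label-injective (trans (label-child true v) (sym e))) (~-child true v)

offset⇒~ : ∀ {m} (t s : Vec Bool m) a b →
           label (node s b) ≡ label (node t a) + 2 ^ m → node t a ~ node s b
offset⇒~ t s false b e = subst (node t false ~_) (label-injective (trans (label-true t) (sym e))) across→
offset⇒~ {m} t s true b e =
  contradiction (subst (2 ^ suc (suc m) ≤_) (sym e) (label-true-overflow t)) (<⇒≱ (label-upper (node s b)))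

Horizontal⇒~ : ∀ v w → Horizontal (label v) (label w) → v ~ w
Horizontal⇒~ v w (i , 1≤i , vᵢ , wᵢ , e) = go v w 1≤i (AtLevel⇒level v vᵢ) (AtLevel⇒level w wᵢ) e
  where
  go : ∀ {i} v w → 1 ≤ i → level v ≡ i → level w ≡ i →
       label w ≡ label v + 2 ^ (i ∸ 1) ⊎ label v ≡ label w + 2 ^ (i ∸ 1) → v ~ w
  go apex       _          () refl _
  go (node t a) (node s b) _  refl refl (inj₁ e) = offset⇒~ t s a b e
  go (node t a) (node s b) _  refl refl (inj₂ e) = ~-sym (offset⇒~ s t b a e)

Adj⇒~ : ∀ n v w → Adj n (label v) (label w) → v ~ w
Adj⇒~ n v w (_ , _ , inj₁ c)        = Child⇒~ v w c
Adj⇒~ n v w (_ , _ , inj₂ (inj₁ c)) = ~-sym (Child⇒~ w v c)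
Adj⇒~ n v w (_ , _ , inj₂ (inj₂ h)) = Horizontal⇒~ v w h

child⇒Child : ∀ c v → Child (label v) (label (child c v))
child⇒Child false v = inj₁ (trans (label-child false v) (+-identityʳ _))
child⇒Child true  v = inj₂ (label-child true v)

~⇒Adj : ∀ {n v w} → level v ≤ n → level w ≤ n → v ~ w → Adj n (label v) (label w)
~⇒Adj {n} {v} {w} v≤n w≤n v~w = level⇒Vertex v v≤n , level⇒Vertex w w≤n , edge v~w
  where
  edge : ∀ {v w} → v ~ w → Child (label v) (label w) ⊎ Child (label w) (label v) ⊎ Horizontal (label v) (label w)
  edge (apex↓ {b})               = inj₁ (child⇒Child b apex)
  edge (apex↑ {b})               = inj₂ (inj₁ (child⇒Child b apex))
  edge (down {t = t} {b} {c})    = inj₁ (child⇒Child c (node t b))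
  edge (up {t = t} {b} {c})      = inj₂ (inj₁ (child⇒Child c (node t b)))
  edge (across→ {m} {t})         = inj₂ (inj₂ (suc m , s≤s z≤n ,
    level⇒AtLevel (node t false) , level⇒AtLevel (node t true) , inj₁ (label-true t)))
  edge (across← {m} {t})         = inj₂ (inj₂ (suc m , s≤s z≤n ,
    level⇒AtLevel (node t true) , level⇒AtLevel (node t false) , inj₂ (label-true t)))

-- Groups of three consecutive levels

-- Indexed by the path alone, so that both sides of the root belong to one group. Paths of length
-- `k` yield `2 ^ k` groups that tile levels `k + 1` to `k + 3`.
data Group {k} (t : Vec Bool k) : Node → Set where
  top : ∀ {b} → Group t (node t b)
  mid : ∀ {b c} → Group t (node (c ∷ t) b)
  bot : ∀ {b c d} → Group t (node (d ∷ c ∷ t) b)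

group-unique : ∀ {k} {t s : Vec Bool k} {v} → Group t v → Group s v → t ≡ s
group-unique top top = refl
group-unique mid mid = refl
group-unique bot bot = refl

level-group : ∀ {k} {t : Vec Bool k} {v} → Group t v → k < level v × level v ≤ 3 + k
level-group top = ≤-refl , s≤s (m≤n+m _ 2)
level-group mid = s≤s (n≤1+n _) , n≤1+n _
level-group bot = s≤s (m≤n+m _ 2) , ≤-refl

-- Enumerating paths and counting bands

paths : ∀ k → List (Vec Bool k)
paths zero    = [] ∷ []
paths (suc k) = map (false ∷_) (paths k) ++ map (true ∷_) (paths k)

∈-paths : ∀ {k} (t : Vec Bool k) → t ∈ paths k
∈-paths []          = here refl
∈-paths (false ∷ t) = ∈-++⁺ˡ (∈-map⁺ _ (∈-paths t))
∈-paths (true ∷ t)  = ∈-++⁺ʳ (map (false ∷_) (paths _)) (∈-map⁺ _ (∈-paths t))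

paths-unique : ∀ k → Unique (paths k)
paths-unique zero    = [] ∷ []
paths-unique (suc k) = Unique.++⁺ (Unique.map⁺ tail-≡ (paths-unique k)) (Unique.map⁺ tail-≡ (paths-unique k)) disjoint
  where
  tail-≡ : ∀ {c} {t s : Vec Bool k} → Vec._∷_ c t ≡ c ∷ s → t ≡ s
  tail-≡ refl = refl
  disjoint : ∀ {t} → ¬ (t ∈ map (false ∷_) (paths k) × t ∈ map (true ∷_) (paths k))
  disjoint (p , q) with ∈-map⁻ _ p | ∈-map⁻ _ q
  ... | _ , _ , refl | _ , _ , ()

length-paths : ∀ k → length (paths k) ≡ 2 ^ k
length-paths zero    = refl
length-paths (suc k) = trans (length-++ (map (false ∷_) (paths k)))
  (cong₂ _+_ (half false) (trans (half true) (sym (+-identityʳ _))))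
  where
  half : ∀ c → length (map (Vec._∷_ c) (paths k)) ≡ 2 ^ k
  half c = trans (length-map (c ∷_) (paths k)) (length-paths k)

length-concatMap-const : {A B : Set} (f : A → List B) (c : ℕ) → (∀ x → length (f x) ≡ c) →
                         ∀ xs → length (concatMap f xs) ≡ c * length xs
length-concatMap-const f c h []       = sym (*-zeroʳ c)
length-concatMap-const f c h (x ∷ xs) = trans (length-++ (f x))
  (trans (cong₂ _+_ (h x) (length-concatMap-const f c h xs)) (sym (*-suc c (length xs))))

All-concatMap : {A B : Set} {P : B → Set} {f : A → List B} → (∀ x → All P (f x)) → ∀ xs → All P (concatMap f xs)
All-concatMap h []       = []
All-concatMap h (x ∷ xs) = All.++⁺ (h x) (All-concatMap h xs)

concatMap-unique : ∀ {k} (f : Vec Bool k → List Node) → (∀ t → Unique (f t)) → (∀ t → All (Group t) (f t)) →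
                   ∀ {ts} → Unique ts → Unique (concatMap f ts)
concatMap-unique f uniq grp []                   = []
concatMap-unique f uniq grp {t ∷ ts} (t∉ts ∷ u) = Unique.++⁺ (uniq t) (concatMap-unique f uniq grp u) disjoint
  where
  disjoint : ∀ {v} → ¬ (v ∈ f t × v ∈ concatMap f ts)
  disjoint (v∈ft , v∈rest) with find (∈-concatMap⁻ f {xs = ts} v∈rest)
  ... | s , s∈ts , v∈fs =
    All.lookup t∉ts s∈ts (group-unique (All.lookup (grp t) v∈ft) (All.lookup (grp s) v∈fs))

-- The optimum for the levels below `k`, when `k` is at least 2; hence `HT(n)` corresponds to
-- `suc n`. Each band adds three vertices for each of its `2 ^ k` groups.
size : ℕ → ℕ
size 0                   = 0
size 1                   = 1
size 2                   = 2
size (suc (suc (suc k))) = size k + 3 * 2 ^ k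

-- Serves both bounds: `xs` stays at levels up to `k` and the band starts at `k + 1`, so the two are
-- disjoint.
append-band : ∀ {k xs} (f : Vec Bool k → List Node) → (∀ t → length (f t) ≡ 3) → (∀ t → Unique (f t)) →
              (∀ t → All (Group t) (f t)) → Unique xs → All (λ v → level v ≤ k) xs → length xs ≡ size k →
              Unique (xs ++ concatMap f (paths k)) × length (xs ++ concatMap f (paths k)) ≡ size (3 + k)
append-band {k} {xs} f len uniq grp u lev l =
  Unique.++⁺ u (concatMap-unique f uniq grp (paths-unique k)) disjoint ,
  trans (length-++ xs) (cong₂ _+_ l (trans (length-concatMap-const f 3 len (paths k)) (cong (3 *_) (length-paths k))))
  where
  disjoint : ∀ {v} → ¬ (v ∈ xs × v ∈ concatMap f (paths k))
  disjoint (v∈xs , v∈band) = <⇒≱ (All.lookup (All-concatMap (λ t → All.map (proj₁ ∘ level-group) (grp t)) (paths k)) v∈band)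
                                 (All.lookup lev v∈xs)

-- Lower bound

module LowerBound
  (n : ℕ) (In : Node → Set) (In? : ∀ v → Dec (In v))
  (dominated : ∀ v → level v ≤ n → ∃[ w ] (In w × v ~ w))
  (located : ∀ u v → level u ≤ n → level v ≤ n → u ≢ v → ¬ In u → ¬ In v → ¬ (∀ w → In w → (u ~ w ⇔ v ~ w)))
  where

  -- The neighbours of node (c ∷ t) b other than its parent; each of them
  -- dominates no other child of the pair at t.
  data Private {k} (t : Vec Bool k) (c b : Bool) : Node → Set where
    mate  : ∀ {a} → a ≡ not b → Private t c b (node (c ∷ t) a)
    below : ∀ {d} → Private t c b (node (d ∷ c ∷ t) b)

  private-unique : ∀ {k} {t : Vec Bool k} {c c′ b b′ v} → Private t c b v → Private t c′ b′ v → c ≡ c′ × b ≡ b′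
  private-unique (mate p) (mate q) = refl , Bool.not-injective (trans (sym p) q)
  private-unique below    below    = refl , refl

  private-≢ : ∀ {k} {t : Vec Bool k} {c c′ b b′ v w} → ¬ (c ≡ c′ × b ≡ b′) →
              Private t c b v → Private t c′ b′ w → v ≢ w
  private-≢ differ p q refl = differ (private-unique p q)

  private⇒group : ∀ {k} {t : Vec Bool k} {c b v} → Private t c b v → Group t v
  private⇒group (mate _) = mid
  private⇒group below    = bot

  top≢private : ∀ {k} {t : Vec Bool k} {a c b v} → Private t c b v → node t a ≢ v
  top≢private (mate _) ()
  top≢private below    ()

  HasPrivate : ∀ {k} → Vec Bool k → Bool → Bool → Set
  HasPrivate t c b = ∃[ v ] (In v × Private t c b v)

  hasPrivate? : ∀ {k} (t : Vec Bool k) c b → Dec (HasPrivate t c b)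
  hasPrivate? t c b with In? (node (c ∷ t) (not b)) | In? (node (false ∷ c ∷ t) b) | In? (node (true ∷ c ∷ t) b)
  ... | yes i | _     | _     = yes (_ , i , mate refl)
  ... | no _  | yes i | _     = yes (_ , i , below)
  ... | no _  | no _  | yes i = yes (_ , i , below)
  ... | no p  | no q  | no r  = no λ where
    (_ , i , mate refl)       → p i
    (_ , i , below {false})   → q i
    (_ , i , below {true})    → r i

  -- Apart from the parent, the only neighbours of a child are its mate and its own children, all of
  -- them private.
  private-dominator : ∀ {k} (t : Vec Bool k) c b → 2 + k ≤ n → ¬ In (node t b) → HasPrivate t c b
  private-dominator t c b k≤n ¬parent with dominated (node (c ∷ t) b) k≤n
  ... | _ , i , up      = contradiction i ¬parent
  ... | _ , i , down    = _ , i , below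
  ... | _ , i , across→ = _ , i , mate refl
  ... | _ , i , across← = _ , i , mate refl

  -- Two siblings cannot both be dominated by their parent alone.
  some-private : ∀ {k} (t : Vec Bool k) → 2 + k ≤ n → ∃[ c ] ∃[ b ] HasPrivate t c b
  some-private t k≤n with hasPrivate? t false true | hasPrivate? t true true | hasPrivate? t false false | hasPrivate? t true false
  ... | yes p | _     | _     | _     = _ , _ , p
  ... | no _  | yes p | _     | _     = _ , _ , p
  ... | no _  | no _  | yes p | _     = _ , _ , p
  ... | no _  | no _  | no _  | yes p = _ , _ , p
  -- Both siblings on the `false` side are mates of vertices on the `true` side, so `p` and `q` put
  -- them outside the set. By `r` and `s` their only possible chosen neighbour is the common parent,
  -- so they are not located.
  ... | no p  | no q  | no r  | no s  = ⊥-elim (located (node (false ∷ t) false) (node (true ∷ t) false) k≤n k≤n (λ ())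
    (λ i → p (_ , i , mate refl)) (λ i → q (_ , i , mate refl))
    (λ w i → mk⇔ (only-parent false r i) (only-parent true s i)))
    where
    only-parent : ∀ c {c′ w} → ¬ HasPrivate t c false → In w → node (c ∷ t) false ~ w → node (c′ ∷ t) false ~ w
    only-parent c none i up      = up
    only-parent c none i down    = ⊥-elim (none (_ , i , below))
    only-parent c none i across→ = ⊥-elim (none (_ , i , mate refl))

  Triple : ∀ {k} → Vec Bool k → Set
  Triple t = ∃[ xs ] (length xs ≡ 3 × Unique xs × All (Group t) xs × All In xs)

  -- The two children of the unchosen top vertex need private dominators, which are distinct; the
  -- chosen top vertex is the third.
  triple-one-top : ∀ {k} (t : Vec Bool k) a b → 2 + k ≤ n → In (node t a) → ¬ In (node t b) → Triple t
  triple-one-top t a b k≤n i ¬j with private-dominator t false b k≤n ¬j | private-dominator t true b k≤n ¬j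
  ... | v , h , p | w , h′ , q = node t a ∷ v ∷ w ∷ [] , refl ,
    (top≢private p ∷ top≢private q ∷ []) ∷ (private-≢ (λ { (() , _) }) p q ∷ []) ∷ [] ∷ [] ,
    top ∷ private⇒group p ∷ private⇒group q ∷ [] , i ∷ h ∷ h′ ∷ []

  triple : ∀ {k} (t : Vec Bool k) → 2 + k ≤ n → Triple t
  triple t k≤n with In? (node t false) | In? (node t true)
  ... | yes i | no ¬j = triple-one-top t false true k≤n i ¬j
  ... | no ¬i | yes j = triple-one-top t true false k≤n j ¬i
  ... | yes i | yes j with some-private t k≤n
  ...   | _ , _ , v , h , p = node t false ∷ node t true ∷ v ∷ [] , refl ,
    ((λ ()) ∷ top≢private p ∷ []) ∷ (top≢private p ∷ []) ∷ [] ∷ [] ,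
    top ∷ top ∷ private⇒group p ∷ [] , i ∷ j ∷ h ∷ []
  -- All four children need private dominators here; three of them are enough.
  triple t k≤n | no ¬i | no ¬j
    with private-dominator t false false k≤n ¬i | private-dominator t true false k≤n ¬i | private-dominator t false true k≤n ¬j
  ... | v , h , p | w , h′ , q | x , h″ , r = v ∷ w ∷ x ∷ [] , refl ,
    (private-≢ (λ { (() , _) }) p q ∷ private-≢ (λ { (_ , ()) }) p r ∷ []) ∷
    (private-≢ (λ { (() , _) }) q r ∷ []) ∷ [] ∷ [] ,
    private⇒group p ∷ private⇒group q ∷ private⇒group r ∷ [] , h ∷ h′ ∷ h″ ∷ []

  ~-irrefl : ∀ {v} → ¬ v ~ v
  ~-irrefl ()

  -- Induction in steps of three levels. A triple uses domination and location only at the middle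
  -- level `k + 2` of its group, so the last band may have its bottom level at `n + 1`, just below
  -- the tree.
  packing : ∀ k → k ≤ suc n → ∃[ xs ] (Unique xs × length xs ≡ size k × All (λ v → level v ≤ k) xs × All In xs)
  packing 0 _ = [] , [] , refl , [] , []
  packing 1 _ with dominated apex z≤n
  ... | _ , i , apex↓ = _ ∷ [] , [] ∷ [] , refl , ≤-refl ∷ [] , i ∷ []
  packing 2 (s≤s 1≤n) with dominated apex z≤n
  -- Domination is total: the chosen neighbour `v` of the apex needs a chosen neighbour too, and
  -- this differs from `v` because there are no loops.
  ... | v@(node [] b) , i , apex↓ with dominated v 1≤n
  ...   | w , j , v~w = v ∷ w ∷ [] , ((λ { refl → ~-irrefl v~w }) ∷ []) ∷ [] ∷ [] , refl , s≤s z≤n ∷ level-w v~w ∷ [] , i ∷ j ∷ []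
    where
    level-w : ∀ {w} → v ~ w → level w ≤ 2
    level-w apex↑   = z≤n
    level-w down    = ≤-refl
    level-w across→ = s≤s z≤n
    level-w across← = s≤s z≤n
  packing (suc (suc (suc k))) (s≤s k≤n) with packing k (≤-trans (m≤n+m k 3) (s≤s k≤n))
  ... | xs , uniq , len , lev , ins = xs ++ concatMap f (paths k) , proj₁ band , proj₂ band ,
          All.++⁺ (All.map (λ l≤k → ≤-trans l≤k (m≤n+m k 3)) lev)
                  (All-concatMap (λ t → All.map (proj₂ ∘ level-group) (grp t)) (paths k)) ,
          All.++⁺ ins (All-concatMap (λ t → proj₂ (proj₂ (proj₂ (proj₂ (triple t k≤n))))) (paths k))
    where
    f : Vec Bool k → List Node
    f t = proj₁ (triple t k≤n)
    grp : ∀ t → All (Group t) (f t)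
    grp t = proj₁ (proj₂ (proj₂ (proj₂ (triple t k≤n))))
    band = append-band f (λ t → proj₁ (proj₂ (triple t k≤n))) (λ t → proj₁ (proj₂ (proj₂ (triple t k≤n)))) grp uniq lev len

-- Membership in `S` is pulled back along `label`; the labels of the packing at `suc n` are then
-- distinct members of `S`.
size-≤-length : ∀ n S → IsLTDS n S → size (suc n) ≤ length S
size-≤-length n S (_ , _ , dom , loc) with LB.packing (suc n) ≤-refl
  where
  open DecMembership _≟_ using (_∈?_)
  dominated : ∀ v → level v ≤ n → ∃[ w ] (label w ∈ S × v ~ w)
  dominated v v≤n with dom (label v) (level⇒Vertex v v≤n)
  ... | x , x∈S , adj with label-surjective x (proj₁ (proj₁ (proj₂ adj)))
  ... | w , refl = w , x∈S , Adj⇒~ n v w adj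
  located : ∀ u v → level u ≤ n → level v ≤ n → u ≢ v → label u ∉ S → label v ∉ S →
            ¬ (∀ w → label w ∈ S → (u ~ w ⇔ v ~ w))
  located u v u≤n v≤n u≢v u∉S v∉S same =
    loc (label u) (label v) (level⇒Vertex u u≤n) (level⇒Vertex v v≤n) (u≢v ∘ label-injective) u∉S v∉S
      λ x x∈S → mk⇔ (transfer u v v≤n (λ w i → Equivalence.to (same w i)) x∈S)
                      (transfer v u u≤n (λ w i → Equivalence.from (same w i)) x∈S)
    where
    transfer : ∀ u v → level v ≤ n → (∀ w → label w ∈ S → u ~ w → v ~ w) → ∀ {x} → x ∈ S → Adj n (label u) x → Adj n (label v) x
    transfer u v v≤n imp {x} x∈S adj with label-surjective x (proj₁ (proj₁ (proj₂ adj)))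
    ... | w , refl = ~⇒Adj v≤n (Vertex⇒level w (proj₁ (proj₂ adj))) (imp w x∈S (Adj⇒~ n u w adj))
  module LB = LowerBound n (λ v → label v ∈ S) (λ v → label v ∈? S) dominated located
... | xs , uniq , len , _ , ins = subst₂ _≤_ (trans (length-map label xs) len) refl
        (unique-⊆⇒length-≤ (Unique.map⁺ label-injective uniq) (All.lookup (All.map⁺ ins)))

-- Upper bound

-- The third vertex serves to locate siblings: on the `false` side it is itself one of them, on the
-- `true` side it is the mate of one.
trio : ∀ {k} → Vec Bool k → List Node
trio t = node t false ∷ node t true ∷ node (false ∷ t) false ∷ []

-- Built to dominate and locate the levels strictly below `k`; this makes it reusable as the upper
-- part of a larger solution.
solution : ℕ → List Node
solution 0                   = []
solution 1                   = node [] false ∷ []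
solution 2                   = node [] false ∷ node [] true ∷ []
solution (suc (suc (suc k))) = solution k ++ concatMap trio (paths k)

level-solution : ∀ k → All (λ v → level v ≤ k) (solution k)
level-solution 0                   = []
level-solution 1                   = ≤-refl ∷ []
level-solution 2                   = s≤s z≤n ∷ s≤s z≤n ∷ []
level-solution (suc (suc (suc k))) = All.++⁺
  (All.map (λ l≤k → ≤-trans l≤k (m≤n+m k 3)) (level-solution k))
  (All-concatMap (λ t → s≤s (m≤n+m k 2) ∷ s≤s (m≤n+m k 2) ∷ n≤1+n _ ∷ []) (paths k))

-- At k = 1 the solution uses a vertex just below the dominated levels.
level-solution-< : ∀ k → All (λ v → level v ≤ suc k) (solution (2 + k))
level-solution-< 0       = ≤-refl ∷ ≤-refl ∷ []
level-solution-< (suc k) = All.++⁺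
  (All.map (λ l≤k → ≤-trans l≤k (m≤n+m k 2)) (level-solution k))
  (All-concatMap (λ t → n≤1+n _ ∷ n≤1+n _ ∷ ≤-refl ∷ []) (paths k))

solution-unique×length : ∀ k → Unique (solution k) × length (solution k) ≡ size k
solution-unique×length 0 = [] , refl
solution-unique×length 1 = [] ∷ [] , refl
solution-unique×length 2 = ((λ ()) ∷ []) ∷ [] ∷ [] , refl
solution-unique×length (suc (suc (suc k))) = append-band trio (λ _ → refl)
  (λ _ → ((λ ()) ∷ (λ ()) ∷ []) ∷ ((λ ()) ∷ []) ∷ [] ∷ []) (λ _ → top ∷ top ∷ mid ∷ [])
  (proj₁ (solution-unique×length k)) (level-solution k) (proj₂ (solution-unique×length k))

trio⊆solution : ∀ {k} (t : Vec Bool k) → trio t ⊆ solution (3 + k)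
trio⊆solution {k} t v∈trio = ∈-++⁺ʳ (solution k) (∈-concatMap⁺ trio (lose (∈-paths t) v∈trio))

top∈solution : ∀ {k} (t : Vec Bool k) b → node t b ∈ solution (3 + k)
top∈solution t false = trio⊆solution t (here refl)
top∈solution t true  = trio⊆solution t (there (here refl))

mid∈solution : ∀ {k} (t : Vec Bool k) → node (false ∷ t) false ∈ solution (3 + k)
mid∈solution t = trio⊆solution t (there (there (here refl)))

child∈solution : ∀ {k} c p → level p ≡ k → child c p ∈ solution (3 + k)
child∈solution c apex       refl = top∈solution [] c
child∈solution c (node t b) refl = top∈solution (c ∷ t) b

-- Levels below `k` are left to the induction; level `k` sits just above the fully chosen level
-- `k + 1`, and level `k + 2` just below it.
data Position (k : ℕ) : Node → Set where
  inner  : ∀ {v} → level v < k → Position k v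
  fringe : ∀ {v} → level v ≡ k → Position k v
  chosen : ∀ (t : Vec Bool k) b → Position k (node t b)
  leaf   : ∀ (t : Vec Bool k) c b → Position k (node (c ∷ t) b)

position : ∀ k v → level v < 3 + k → Position k v
position k v (s≤s l≤2+k) with m≤n⇒m<n∨m≡n l≤2+k
position k (node (c ∷ t) b) _ | inj₂ refl = leaf t c b
... | inj₁ (s≤s l≤1+k) with m≤n⇒m<n∨m≡n l≤1+k
position k (node t b) _ | inj₁ _ | inj₂ refl = chosen t b
... | inj₁ (s≤s l≤k) with m≤n⇒m<n∨m≡n l≤k
...   | inj₁ l<k = inner l<k
...   | inj₂ l≡k = fringe l≡k

-- Domination by the solution

Dominates : ℕ → List Node → Set
Dominates k S = ∀ v → level v < k → ∃[ w ] (w ∈ S × v ~ w)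

solution-dominates : ∀ k → Dominates k (solution k)
solution-dominates 1 apex _ = _ , here refl , apex↓
solution-dominates 1 (node _ _) (s≤s ())
solution-dominates 2 apex _ = _ , here refl , apex↓
solution-dominates 2 (node [] false) _ = _ , there (here refl) , across→
solution-dominates 2 (node [] true)  _ = _ , here refl , across←
solution-dominates 2 (node (_ ∷ _) _) (s≤s (s≤s ()))
solution-dominates (suc (suc (suc k))) v l with position k v l
... | inner l<k       = let w , w∈S , v~w = solution-dominates k v l<k in w , ∈-++⁺ˡ w∈S , v~w
... | fringe l≡k      = child false v , child∈solution false v l≡k , ~-child false v
... | chosen t false  = _ , top∈solution t true , across→
... | chosen t true   = _ , top∈solution t false , across←
... | leaf t c b      = _ , top∈solution t b , up

-- Location by the solution

Separates : Node → Node → Node → Set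
Separates w u v = (u ~ w × ¬ v ~ w) ⊎ (v ~ w × ¬ u ~ w)

separates-sym : ∀ {w u v} → Separates w u v → Separates w v u
separates-sym (inj₁ s) = inj₂ s
separates-sym (inj₂ s) = inj₁ s

-- An explicit separating vertex, constructively stronger than the negated agreement that `IsLTDS`
-- asks for.
Located : List Node → Node → Node → Set
Located S u v = ∃[ w ] (w ∈ S × Separates w u v)

located-sym : ∀ {S u v} → Located S u v → Located S v u
located-sym (w , w∈S , s) = w , w∈S , separates-sym s

~⇒level-≤ : ∀ {v w} → v ~ w → level w ≤ suc (level v)
~⇒level-≤ apex↓   = ≤-refl
~⇒level-≤ apex↑   = z≤n
~⇒level-≤ down    = ≤-refl
~⇒level-≤ up      = ≤-trans (n≤1+n _) (n≤1+n _)
~⇒level-≤ across→ = n≤1+n _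
~⇒level-≤ across← = n≤1+n _

parent-unique : ∀ c p {u} → u ~ child c p → level u ≡ level p → u ≡ p
parent-unique c apex       {apex} _    _  = refl
parent-unique c (node t b)        down _  = refl
parent-unique c (node t b)        up   ()
parent-unique c (node t b)        across→ ()
parent-unique c (node t b)        across← ()

leaf-parent : ∀ {k} {t : Vec Bool k} {c b w} → node (c ∷ t) b ~ w → level w ≡ suc k → w ≡ node t b
leaf-parent up      _  = refl
leaf-parent down    ()
leaf-parent across→ ()
leaf-parent across← ()

other-child : ∀ {k} p (t : Vec Bool k) b → level p ≡ k → ∃[ d ] child d p ≢ node t b
other-child apex       []          false refl = true , λ ()
other-child apex       []          true  refl = false , λ ()
other-child (node s a) (false ∷ t) b     refl = true , λ ()
other-child (node s a) (true ∷ t)  b     refl = false , λ ()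

module _ {k : ℕ} where

  -- An edge descends by at most one level, whereas the chosen level lies at least two below an
  -- inner vertex.
  inner≁ : ∀ {u w} → level u < k → level w ≡ suc k → ¬ u ~ w
  inner≁ l<k e u~w = <⇒≱ l<k (s≤s⁻¹ (subst (_≤ _) e (~⇒level-≤ u~w)))

  level-child-≡ : ∀ c p → level p ≡ k → level (child c p) ≡ suc k
  level-child-≡ c p e = trans (level-child c p) (cong suc e)

  inner-fringe : ∀ {u v} → level u < k → level v ≡ k → Located (solution (3 + k)) u v
  inner-fringe {u} {v} l<k l≡k = child false v , child∈solution false v l≡k ,
    inj₂ (~-child false v , inner≁ l<k (level-child-≡ false v l≡k))

  inner-leaf : ∀ {u} → level u < k → ∀ (t : Vec Bool k) c b → Located (solution (3 + k)) u (node (c ∷ t) b)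
  inner-leaf l<k t c b = node t b , top∈solution t b , inj₂ (up , inner≁ l<k refl)

  fringe-fringe : ∀ {u v} → level u ≡ k → level v ≡ k → u ≢ v → Located (solution (3 + k)) u v
  fringe-fringe {u} {v} lu lv u≢v = child false u , child∈solution false u lu ,
    inj₁ (~-child false u , λ v~ → u≢v (sym (parent-unique false u v~ (trans lv (sym lu)))))

  -- Both children of `u` are chosen, but a leaf has only its parent in the chosen level; the child
  -- of `u` that is not this parent separates.
  fringe-leaf : ∀ {u} → level u ≡ k → ∀ (t : Vec Bool k) c b → Located (solution (3 + k)) u (node (c ∷ t) b)
  fringe-leaf {u} lu t c b with other-child u t b lu
  ... | d , ≢parent = child d u , child∈solution d u lu ,
    inj₁ (~-child d u , λ leaf~ → ≢parent (leaf-parent leaf~ (level-child-≡ d u lu)))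

  -- On the `false` side one sibling is chosen, against the assumption. On the `true` side the
  -- chosen vertex below `node t false` is adjacent to exactly one sibling.
  siblings : ∀ (t : Vec Bool k) c d b → c ≢ d →
             node (c ∷ t) b ∉ solution (3 + k) → node (d ∷ t) b ∉ solution (3 + k) →
             Located (solution (3 + k)) (node (c ∷ t) b) (node (d ∷ t) b)
  siblings t false false b     c≢d _ _   = contradiction refl c≢d
  siblings t true  true  b     c≢d _ _   = contradiction refl c≢d
  siblings t false true  false _ u∉S _   = contradiction (mid∈solution t) u∉S
  siblings t true  false false _ _   v∉S = contradiction (mid∈solution t) v∉S
  siblings t false true  true  _ _   _   = _ , mid∈solution t , inj₁ (across← , λ ())
  siblings t true  false true  _ _   _   = _ , mid∈solution t , inj₂ (across← , λ ())

  leaf-leaf : ∀ (t s : Vec Bool k) c d a b → node (c ∷ t) a ≢ node (d ∷ s) b →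
              node (c ∷ t) a ∉ solution (3 + k) → node (d ∷ s) b ∉ solution (3 + k) →
              Located (solution (3 + k)) (node (c ∷ t) a) (node (d ∷ s) b)
  -- Comparing labels decides whether the parents coincide; if they do not, a parent already
  -- separates.
  leaf-leaf t s c d a b u≢v u∉S v∉S with label (node t a) ≟ label (node s b)
  ... | no  ≢parent = node t a , top∈solution t a ,
    inj₁ (up , λ v~ → ≢parent (cong label (leaf-parent v~ refl)))
  ... | yes ≡parent with label-injective {node t a} {node s b} ≡parent
  ...   | refl = siblings t c d a (λ { refl → u≢v refl }) u∉S v∉S

Locates : ℕ → List Node → Set
Locates k S = ∀ u v → level u < k → level v < k → u ≢ v → u ∉ S → v ∉ S → Located S u v

solution-locates : ∀ k → Locates k (solution k)
solution-locates 1 apex       apex       _ _ u≢v _ _ = contradiction refl u≢v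
solution-locates 1 (node _ _) _          (s≤s ())
solution-locates 1 apex       (node _ _) _ (s≤s ())
solution-locates 2 apex             apex            _ _ u≢v _ _ = contradiction refl u≢v
solution-locates 2 (node [] false)  _               _ _ _ u∉S _ = contradiction (here refl) u∉S
solution-locates 2 (node [] true)   _               _ _ _ u∉S _ = contradiction (there (here refl)) u∉S
solution-locates 2 apex             (node [] false) _ _ _ _ v∉S = contradiction (here refl) v∉S
solution-locates 2 apex             (node [] true)  _ _ _ _ v∉S = contradiction (there (here refl)) v∉S
solution-locates 2 (node (_ ∷ _) _) _ (s≤s (s≤s ()))
solution-locates 2 apex (node (_ ∷ _) _) _ (s≤s (s≤s ()))
solution-locates (suc (suc (suc k))) u v lu lv u≢v u∉S v∉S with position k u lu | position k v lv
... | chosen t b  | _           = contradiction (top∈solution t b) u∉S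
... | inner _     | chosen t b  = contradiction (top∈solution t b) v∉S
... | fringe _    | chosen t b  = contradiction (top∈solution t b) v∉S
... | leaf _ _ _  | chosen t b  = contradiction (top∈solution t b) v∉S
... | inner p     | inner q     =
  let w , w∈S , sep = solution-locates k u v p q u≢v (u∉S ∘ ∈-++⁺ˡ) (v∉S ∘ ∈-++⁺ˡ) in w , ∈-++⁺ˡ w∈S , sep
... | inner p     | fringe q    = inner-fringe p q
... | inner p     | leaf t c b  = inner-leaf p t c b
... | fringe p    | inner q     = located-sym (inner-fringe q p)
... | fringe p    | fringe q    = fringe-fringe p q u≢v
... | fringe p    | leaf t c b  = fringe-leaf p t c b
... | leaf t c b  | inner q     = located-sym (inner-leaf q t c b)
... | leaf t c b  | fringe q    = located-sym (fringe-leaf q t c b)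
... | leaf t c a  | leaf s d b  = leaf-leaf t s c d a b u≢v u∉S v∉S

-- Height 0 must be excluded: `solution 1` lies at level 1, outside the one-vertex tree, which has
-- no total dominating set.
solution-IsLTDS : ∀ n → 1 ≤ n → IsLTDS n (map label (solution (suc n)))
solution-IsLTDS n@(suc m) _ =
  Unique.map⁺ label-injective (proj₁ (solution-unique×length (suc n))) ,
  All.map⁺ (All.map (λ {v} → level⇒Vertex v) (level-solution-< m)) ,
  dominates , locates
  where
  S = solution (suc n)

  level≤n : ∀ {w} → w ∈ S → level w ≤ n
  level≤n = All.lookup (level-solution-< m)

  dominates : ∀ x → Vertex n x → ∃[ y ] (y ∈ map label S × Adj n x y)
  dominates x vx with label-surjective x (proj₁ vx)
  ... | v , refl with solution-dominates (suc n) v (s≤s (Vertex⇒level v vx))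
  ...   | w , w∈S , v~w = label w , ∈-map⁺ label w∈S , ~⇒Adj (Vertex⇒level v vx) (level≤n w∈S) v~w

  locates : ∀ x y → Vertex n x → Vertex n y → x ≢ y → x ∉ map label S → y ∉ map label S →
            ¬ (∀ z → z ∈ map label S → (Adj n x z ⇔ Adj n y z))
  locates x y vx vy x≢y x∉S y∉S same with label-surjective x (proj₁ vx) | label-surjective y (proj₁ vy)
  ... | u , refl | v , refl
    with solution-locates (suc n) u v (s≤s (Vertex⇒level u vx)) (s≤s (Vertex⇒level v vy))
           (x≢y ∘ cong label) (x∉S ∘ ∈-map⁺ label) (y∉S ∘ ∈-map⁺ label)
  ... | w , w∈S , inj₁ (u~w , v≁w) = v≁w (Adj⇒~ n v w
    (Equivalence.to (same (label w) (∈-map⁺ label w∈S)) (~⇒Adj (Vertex⇒level u vx) (level≤n w∈S) u~w)))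
  ... | w , w∈S , inj₂ (v~w , u≁w) = u≁w (Adj⇒~ n u w
    (Equivalence.from (same (label w) (∈-map⁺ label w∈S)) (~⇒Adj (Vertex⇒level v vy) (level≤n w∈S) v~w)))

-- Closed forms for the size

size-step : ∀ k r → 7 * size k ≡ 3 * 2 ^ k + r → 7 * size (3 + k) ≡ 3 * 2 ^ (3 + k) + r
-- The remainder `r` survives a band because 3p + 21p = 24p, which is 3 times `2 ^ (3 + k)` for p =
-- `2 ^ k`.
size-step k r e = trans (*-distribˡ-+ 7 (size k) (3 * 2 ^ k))
  (trans (cong (_+ 7 * (3 * 2 ^ k)) e) (octuple (2 ^ k) r))
  where
  octuple : ∀ p r → 3 * p + r + 7 * (3 * p) ≡ 3 * (2 * (2 * (2 * p))) + r
  octuple = solve-∀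

size-0mod3 : ∀ n → n % 3 ≡ 0 → 7 * size (suc n) ≡ 3 * 2 ^ suc n + 1
size-0mod3 0                   _ = refl
size-0mod3 (suc (suc (suc n))) e = size-step (suc n) 1 (size-0mod3 n e)

size-1mod3 : ∀ n → n % 3 ≡ 1 → 7 * size (suc n) ≡ 3 * 2 ^ suc n + 2
size-1mod3 1                   _ = refl
size-1mod3 (suc (suc (suc n))) e = size-step (suc n) 2 (size-1mod3 n e)

-- The remainder is now -3, so the induction runs on the equation with 3 moved to the left, which
-- avoids truncated subtraction.
size-2mod3 : ∀ n → n % 3 ≡ 2 → 7 * size (suc n) ≡ 3 * (2 ^ suc n ∸ 1)
size-2mod3 n e = trans (sym (m+n∸n≡m (7 * size (suc n)) 3))
  (trans (cong (_∸ 3) (shifted n e)) (sym (*-distribˡ-∸ 3 (2 ^ suc n) 1)))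
  where
  shifted : ∀ n → n % 3 ≡ 2 → 7 * size (suc n) + 3 ≡ 3 * 2 ^ suc n
  shifted 2                   _ = refl
  shifted (suc (suc (suc n))) e = trans (regroup (size (suc n)) (2 ^ suc n))
    (trans (cong (_+ 21 * 2 ^ suc n) (shifted n e)) (octuple (2 ^ suc n)))
    where
    regroup : ∀ s p → 7 * (s + 3 * p) + 3 ≡ 7 * s + 3 + 21 * p
    regroup = solve-∀
    octuple : ∀ p → 3 * p + 21 * p ≡ 3 * (2 * (2 * (2 * p)))
    octuple = solve-∀

theorem4 : (n : ℕ) → 1 ≤ n →
    Σ ℕ λ k → IsLTDNumber n k ×
    (n % 3 ≡ 0 → 7 * k ≡ 3 * 2 ^ (n + 1) + 1) ×
    (n % 3 ≡ 1 → 7 * k ≡ 2 * (3 * 2 ^ n + 1)) ×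
    (n % 3 ≡ 2 → 7 * k ≡ 3 * (2 ^ (n + 1) ∸ 1))
theorem4 n 1≤n = size (suc n) ,
  ((_ , solution-IsLTDS n 1≤n ,
    trans (length-map label (solution (suc n))) (proj₂ (solution-unique×length (suc n)))) , size-≤-length n) ,
  (λ e → trans (size-0mod3 n e) (cong (λ m → 3 * 2 ^ m + 1) (+-comm 1 n))) ,
  (λ e → trans (size-1mod3 n e) (factor (2 ^ n))) ,
  (λ e → trans (size-2mod3 n e) (cong (λ m → 3 * (2 ^ m ∸ 1)) (+-comm 1 n)))
  where
  factor : ∀ p → 3 * (2 * p) + 2 ≡ 2 * (3 * p + 1)
  factor = solve-∀
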